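{- There exists an infinite family of $4$-edge-critical $4$-regular planar graphs $G$ with fractional chromatic number $\chi_f(G)=3$.
   Context: A graph is $4$-edge-critical if it has chromatic number $4$ and deleting any edge decreases the chromatic number. The fractional chromatic number is $\chi_f(G)=\inf_b \chi_b(G)/b$, where $\chi_b(G)$ is the least $m$ such that each vertex can be assigned a $b$-element subset of $\{1,\dots,m\}$ with adjacent vertices receiving disjoint subsets. -}

module Defs where

open import Data.Nat using (ℕ; zero; suc; _+_; _*_; _≤_; _<_)
open import Data.Bool using (Bool; true; false; T)
open import Data.Fin using (Fin)
open import Data.Fin.Subset using (Subset; _∩_; ∣_∣; Empty)
open import Data.List using (filterᵇ; length; allFin)
open import Data.Product using (Σ; ∃; _×_; _,_)
open import Data.Rational using (ℚ; 0ℚ; 1ℚ) renaming (_+_ to _+ℚ_; _*_ to _*ℚ_; _-_ to _-ℚ_; _≤_ to _≤ℚ_)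
open import Relation.Nullary using (¬_)
open import Relation.Binary.PropositionalEquality using (_≡_; _≢_)

record Graph : Set where
  field
    n     : ℕ
    adj   : Fin n → Fin n → Bool
    sym   : ∀ u v → adj u v ≡ adj v u
    irrefl : ∀ v → adj v v ≡ false

open Graph public

Adj : (G : Graph) → Fin (n G) → Fin (n G) → Set
Adj G u v = T (adj G u v)

degree : (G : Graph) → Fin (n G) → ℕ
degree G v = length (filterᵇ (adj G v) (allFin (n G)))

Regular : ℕ → Graph → Set
Regular d G = ∀ v → degree G v ≡ d

ProperColouring : {m : ℕ} → (Fin m → Fin m → Set) → (k : ℕ) → (Fin m → Fin k) → Set
ProperColouring E k c = ∀ u v → E u v → c u ≢ c v

ColourableRel : {m : ℕ} → (Fin m → Fin m → Set) → ℕ → Set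
ColourableRel {m} E k = Σ (Fin m → Fin k) (ProperColouring E k)

Colourable : Graph → ℕ → Set
Colourable G k = ColourableRel (Adj G) k

ChromaticNumber : Graph → ℕ → Set
ChromaticNumber G k = Colourable G k × (∀ j → j < k → ¬ Colourable G j)

DeleteEdge : (G : Graph) → Fin (n G) → Fin (n G) → Fin (n G) → Fin (n G) → Set
DeleteEdge G u v x y = Adj G x y × ¬ (x ≡ u × y ≡ v) × ¬ (x ≡ v × y ≡ u)

EdgeCritical : ℕ → Graph → Set
EdgeCritical k G =
  ChromaticNumber G k ×
  (∀ u v → Adj G u v → ∃ λ j → j < k × ColourableRel (DeleteEdge G u v) j)

BFoldColouring : (G : Graph) → (b m : ℕ) → (Fin (n G) → Subset m) → Set
BFoldColouring G b m f =
  (∀ v → ∣ f v ∣ ≡ b) × (∀ u v → Adj G u v → Empty (f u ∩ f v))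

HasBFold : Graph → ℕ → ℕ → Set
HasBFold G b m = Σ (Fin (n G) → Subset m) (BFoldColouring G b m)

-- χ_f(G) = inf_{b ≥ 1} χ_b(G)/b equals the natural number r:
--  * lower bound: for all b ≥ 1, χ_b(G)/b ≥ r, i.e. no b-fold colouring
--    with m < r·b colours;
--  * infimum: for every rational ε = p/q > 0 there is b ≥ 1 with
--    χ_b(G)/b < r + p/q, i.e. a b-fold colouring with m colours,
--    m·q < (r·q + p)·b.
FractionalChromaticNumber : Graph → ℕ → Set
FractionalChromaticNumber G r =
  (∀ b m → 1 ≤ b → m < r * b → ¬ HasBFold G b m) ×
  (∀ p q → 1 ≤ p → 1 ≤ q →
     ∃ λ b → ∃ λ m → 1 ≤ b × HasBFold G b m × (m * q < (r * q + p) * b))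

-- Planarity, via straight-line drawings with rational coordinates
-- (Fáry's theorem; rational coordinates can always be achieved by a
-- small perturbation).

Point : Set
Point = ℚ × ℚ

OnSegment : Point → Point → Point → Set
OnSegment (ax , ay) (bx , by) (cx , cy) =
  ∃ λ (t : ℚ) → 0ℚ ≤ℚ t × t ≤ℚ 1ℚ ×
    (cx ≡ ax +ℚ t *ℚ (bx -ℚ ax)) × (cy ≡ ay +ℚ t *ℚ (by -ℚ ay))

SegmentsMeet : Point → Point → Point → Point → Set
SegmentsMeet a b c d = ∃ λ (z : Point) → OnSegment a b z × OnSegment c d z

PlaneDrawing : (G : Graph) → (Fin (n G) → Point) → Set
PlaneDrawing G pos =
  (∀ u v → pos u ≡ pos v → u ≡ v) ×
  (∀ u v w → Adj G u v → w ≢ u → w ≢ v → ¬ OnSegment (pos u) (pos v) (pos w)) ×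
  (∀ u v x y → Adj G u v → Adj G x y → u ≢ x → u ≢ y → v ≢ x → v ≢ y →
     ¬ SegmentsMeet (pos u) (pos v) (pos x) (pos y))

Planar : Graph → Set
Planar G = Σ (Fin (n G) → Point) (PlaneDrawing G)

{-# OPTIONS --safe #-}

-- The graphs are Ore compositions.  A (a planar 4-edge-critical graph whose degrees are 4 except
-- at two adjacent vertices of degree 3, minus the edge joining these) is a block with two
-- terminals of degree 2 that every 3-colouring colours alike.  B (a planar 4-regular 4-edge-critical
-- graph with χ_f = 3 in which one vertex is split into two terminals of degree 2) is a block whose
-- terminals every 3-colouring colours differently.  A ring made of one B and any number of A's is
-- 4-regular and not 3-colourable.  Deleting an edge of A (of B) lets its terminals differ (agree),
-- which breaks the contradiction.  A 2-fold 6-colouring of B that agrees on the terminals extends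
-- around the ring, since each A has a proper 3-colouring that agrees on its terminals.
-- In the drawing the A's hang below the x-axis side by side, and B, stretched horizontally, spans
-- all of them from above.
module Submission where

open import Defs
open import Data.Bool as Bool using (Bool; true; false; T; _∧_; _∨_; not; if_then_else_)
open import Data.Bool.ListAction using (any)
open import Data.Bool.Properties using (T?; T-∨)
open import Data.Empty using (⊥-elim)
open import Data.Fin using (Fin; zero; suc; #_; fromℕ; inject₁; inject≤; toℕ; remQuot; combine)
open import Data.Fin.Induction using (<-weakInduction)
open import Data.Fin.Properties using (all?; _≟_; fromℕ≢inject₁; inject₁-injective; suc-injective; toℕ-inject₁; toℕ-fromℕ; toℕ<n; toℕ-injective; inject≤-injective; remQuot-combine; combine-remQuot)
open import Data.Fin.Relation.Unary.Top using (view; ‵fromℕ; ‵inject₁)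
open import Data.Fin.Subset using (Subset; _∩_; _∪_; ⁅_⁆; ∣_∣; Empty)
open import Data.Fin.Subset.Properties using (nonempty?; drop-∷-Empty; x∈p∩q⁻; x∈p∩q⁺; x∈p∪q⁻; ∣p∣≤n)
open import Data.Integer as ℤ using (ℤ; +_)
import Data.Integer.Properties as ℤ
import Data.Integer.Solver as ℤSolver
open import Data.List as List using (List; _∷_; []; map; _++_; foldr; filterᵇ; length; allFin)
open import Data.List.Membership.Propositional using (_∈_)
open import Data.List.Membership.Propositional.Properties using (∈-map⁺; ∈-map⁻; ∈-++⁺ˡ; ∈-++⁺ʳ; ∈-++⁻; ∈-filter⁺; ∈-filter⁻; ∈-allFin)
open import Data.List.Membership.Propositional.Properties.WithK using (unique∧set⇒bag)
open import Data.List.Properties using (length-map; length-++)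
open import Data.List.Relation.Binary.BagAndSetEquality using (∼bag⇒↭)
open import Data.List.Relation.Binary.Permutation.Propositional.Properties using (↭-length)
open import Data.List.Relation.Unary.All using (All; _∷_; [])
open import Data.List.Relation.Unary.Any using (Any; here; there; any?; satisfied)
open import Data.List.Relation.Unary.Unique.Propositional using (Unique)
import Data.List.Relation.Unary.Unique.Propositional.Properties as Unique
open import Data.Maybe using (Maybe; just; nothing; _<∣>_; fromMaybe; is-just)
open import Data.Nat as ℕ using (ℕ; zero; suc; _≤_; _≡ᵇ_; z≤n; s≤s)
import Data.Nat.Coprimality as Coprimality
import Data.Nat.Properties as ℕ
import Data.Nat.Solver as ℕSolver
open import Data.Product using (∃; _×_; _,_; proj₁; proj₂; uncurry)
open import Data.Rational as ℚ using (ℚ; mkℚ; 0ℚ; 1ℚ)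
import Data.Rational.Properties as ℚ
import Data.Rational.Solver as ℚSolver
import Data.Rational.Unnormalised as ℚᵘ
import Data.Rational.Unnormalised.Properties as ℚᵘ
open import Data.Sum using (_⊎_; inj₁; inj₂; [_,_]′)
open import Data.Vec as Vec using (Vec; _∷_; []; lookup)
open import Function using (_∘_; mk⇔)
open import Function.Bundles using (Equivalence)
open import Relation.Binary.Definitions using (tri<; tri≈; tri>)
open import Relation.Binary.PropositionalEquality as ≡ using (_≡_; _≢_; refl; cong; cong₂; subst; subst₂)
open import Relation.Nullary using (¬_; Dec; yes; no; _×-dec_; _⊎-dec_; _→-dec_; ¬?)
open import Relation.Nullary.Decidable using (isYes; toWitness; True)

-- Separation of segments

-- Built from the constructor with denominator 1, so that injectivity follows by matching on `refl`.
fromℤ : ℤ → ℚ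
fromℤ z = mkℚ z 0 (Coprimality.sym (Coprimality.1-coprimeTo _))

fromℤ-+ : ∀ x y → fromℤ (x ℤ.+ y) ≡ fromℤ x ℚ.+ fromℤ y
fromℤ-+ x y = ℚ.toℚᵘ-injective (ℚᵘ.≃-sym (ℚᵘ.≃-trans (ℚ.toℚᵘ-homo-+ (fromℤ x) (fromℤ y))
  (ℚᵘ.*≡* (cong (ℤ._* ℤ.1ℤ) (cong₂ ℤ._+_ (ℤ.*-identityʳ x) (ℤ.*-identityʳ y))))))

fromℤ-* : ∀ x y → fromℤ (x ℤ.* y) ≡ fromℤ x ℚ.* fromℤ y
fromℤ-* x y = ℚ.toℚᵘ-injective (ℚᵘ.≃-sym (ℚ.toℚᵘ-homo-* (fromℤ x) (fromℤ y)))

fromℤ-mono-< : ∀ {x y} → x ℤ.< y → fromℤ x ℚ.< fromℤ y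
fromℤ-mono-< x<y = ℚ.*<* (subst₂ ℤ._<_ (≡.sym (ℤ.*-identityʳ _)) (≡.sym (ℤ.*-identityʳ _)) x<y)

fromℤ-injective : ∀ {x y} → fromℤ x ≡ fromℤ y → x ≡ y
fromℤ-injective refl = refl

0≤q-p : ∀ {p q} → p ℚ.≤ q → 0ℚ ℚ.≤ q ℚ.- p
0≤q-p {p} {q} p≤q = subst (ℚ._≤ q ℚ.- p) (ℚ.+-inverseʳ p) (ℚ.+-monoˡ-≤ (ℚ.- p) p≤q)

lerp : ℚ → ℚ → ℚ → ℚ
lerp t u v = u ℚ.+ t ℚ.* (v ℚ.- u)

-- The interpolated value is at most the larger of `u` and `v`; the case split on their order tells
-- which one that is.
lerp-< : ∀ {t u v w} → 0ℚ ℚ.≤ t → t ℚ.≤ 1ℚ → u ℚ.< w → v ℚ.< w → lerp t u v ℚ.< w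
lerp-< {t} {u} {v} {w} 0≤t t≤1 u<w v<w with ℚ.≤-total u v
... | inj₁ u≤v = ℚ.≤-<-trans (begin
    u ℚ.+ t ℚ.* (v ℚ.- u)   ≤⟨ ℚ.+-monoʳ-≤ u (ℚ.*-monoʳ-≤-nonNeg (v ℚ.- u) {{ℚ.nonNegative (0≤q-p u≤v)}} t≤1) ⟩
    u ℚ.+ 1ℚ ℚ.* (v ℚ.- u)  ≡⟨ solve 2 (λ u v → u :+ con 1ℚ :* (v :- u) := v) refl u v ⟩
    v                       ∎) v<w
  where open ℚ.≤-Reasoning; open ℚSolver.+-*-Solver
... | inj₂ v≤u = ℚ.≤-<-trans (begin
    u ℚ.+ t ℚ.* (v ℚ.- u)   ≡⟨ solve 3 (λ t u v → u :+ t :* (v :- u) := u :- (t :* (u :- v))) refl t u v ⟩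
    u ℚ.- t ℚ.* (u ℚ.- v)   ≤⟨ ℚ.+-monoʳ-≤ u (ℚ.neg-antimono-≤ (ℚ.*-monoʳ-≤-nonNeg (u ℚ.- v) {{ℚ.nonNegative (0≤q-p v≤u)}} 0≤t)) ⟩
    u ℚ.- 0ℚ ℚ.* (u ℚ.- v)  ≡⟨ solve 2 (λ u v → u :- con 0ℚ :* (u :- v) := u) refl u v ⟩
    u                       ∎) u<w
  where open ℚ.≤-Reasoning; open ℚSolver.+-*-Solver

-- Negation reverses the order and commutes with interpolation, so this mirrors the upper bound.
<-lerp : ∀ {t u v w} → 0ℚ ℚ.≤ t → t ℚ.≤ 1ℚ → w ℚ.< u → w ℚ.< v → w ℚ.< lerp t u v
<-lerp {t} {u} {v} {w} 0≤t t≤1 w<u w<v = subst₂ ℚ._<_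
  (solve 1 (λ w → :- (:- w) := w) refl w)
  (solve 3 (λ t u v → :- ((:- u) :+ t :* ((:- v) :- (:- u))) := u :+ t :* (v :- u)) refl t u v)
  (ℚ.neg-antimono-< (lerp-< {t} 0≤t t≤1 (ℚ.neg-antimono-< w<u) (ℚ.neg-antimono-< w<v)))
  where open ℚSolver.+-*-Solver

ℤPoint : Set
ℤPoint = ℤ × ℤ

value : ℤPoint → ℤPoint → ℤ
value (α , β) (x , y) = α ℤ.* x ℤ.+ β ℤ.* y

valueℚ : ℤPoint → Point → ℚ
valueℚ (α , β) (x , y) = fromℤ α ℚ.* x ℚ.+ fromℤ β ℚ.* y

-- A strictly separating line for the segments `ab` and `cd`, with normal `n`. Only the four
-- endpoints are tested, so evaluation in the integers decides it.
SeparatedBy : ℤPoint → (a b c d : ℤPoint) → Set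
SeparatedBy n a b c d =
  value n a ℤ.< value n c × value n a ℤ.< value n d × value n b ℤ.< value n c × value n b ℤ.< value n d

toPoint : ℤPoint → Point
toPoint (x , y) = fromℤ x , fromℤ y

value-toPoint : ∀ n a → valueℚ n (toPoint a) ≡ fromℤ (value n a)
value-toPoint (α , β) (x , y) = ≡.sym (≡.trans (fromℤ-+ (α ℤ.* x) (β ℤ.* y)) (cong₂ ℚ._+_ (fromℤ-* α x) (fromℤ-* β y)))

-- A linear functional is affine along a segment, with the same parameter `t`.
value-onSegment : ∀ n a b z → ((t , _) : OnSegment a b z) → valueℚ n z ≡ lerp t (valueℚ n a) (valueℚ n b)
value-onSegment (α , β) (ax , ay) (bx , by) z (t , _ , _ , refl , refl) =
  solve 7 (λ α β ax ay bx by t →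
      α :* (ax :+ t :* (bx :- ax)) :+ β :* (ay :+ t :* (by :- ay))
      := (α :* ax :+ β :* ay) :+ t :* ((α :* bx :+ β :* by) :- (α :* ax :+ β :* ay)))
    refl (fromℤ α) (fromℤ β) ax ay bx by t
  where open ℚSolver.+-*-Solver

-- Being on the first segment, a common point `z` has a value below those of `c` and `d`, hence
-- below that of every point of the second segment, `z` included.
separated⇒¬meet : ∀ n {a b c d} → SeparatedBy n a b c d →
                  ¬ SegmentsMeet (toPoint a) (toPoint b) (toPoint c) (toPoint d)
separated⇒¬meet n {a} {b} {c} {d} (ac , ad , bc , bd)
  (z , ab@(t , 0≤t , t≤1 , _) , cd@(s , 0≤s , s≤1 , _)) =
  ℚ.<-irrefl refl (subst (valueℚ n z ℚ.<_) (≡.sym (value-onSegment n (toPoint c) (toPoint d) z cd))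
    (<-lerp {s} {valueℚ n (toPoint c)} {valueℚ n (toPoint d)} 0≤s s≤1 (z< ac bc) (z< ad bd)))
  where
  z< : ∀ {e} → value n a ℤ.< value n e → value n b ℤ.< value n e → valueℚ n z ℚ.< valueℚ n (toPoint e)
  z< {e} a<e b<e = subst₂ ℚ._<_ (≡.sym (value-onSegment n (toPoint a) (toPoint b) z ab)) (≡.sym (value-toPoint n e))
    (lerp-< {t} {valueℚ n (toPoint a)} {valueℚ n (toPoint b)} 0≤t t≤1
      (subst (ℚ._< fromℤ (value n e)) (≡.sym (value-toPoint n a)) (fromℤ-mono-< a<e))
      (subst (ℚ._< fromℤ (value n e)) (≡.sym (value-toPoint n b)) (fromℤ-mono-< b<e)))

-- Backtracking search for colourings

Proper : {m : ℕ} {C : Set} → (Fin m → Fin m → Bool) → (Fin m → C) → Set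
Proper E c = ∀ p q → T (E p q) → c p ≢ c q

module Search {m r : ℕ} (E : Fin m → Fin m → Bool) where

  Partial : Set
  Partial = List (Fin m × Fin r)

  clash : Fin m → Fin r → Partial → Bool
  clash v k = any (λ (w , l) → E v w ∧ isYes (k ≟ l))

  mutual
    extend : List (Fin m) → Partial → Maybe Partial
    extend []       a = just a
    extend (v ∷ vs) a = foldr (λ k rest → try v vs a k <∣> rest) nothing (allFin r)

    try : Fin m → List (Fin m) → Partial → Fin r → Maybe Partial
    try v vs a k = if clash v k a then nothing else extend vs ((v , k) ∷ a)

  Agrees : (Fin m → Fin r) → Partial → Set
  Agrees c = All (λ (w , l) → c w ≡ l)

  clash-sound : ∀ {c v} → Proper E c → ∀ a → Agrees c a → ¬ T (clash v (c v) a)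
  clash-sound {c} {v} pr ((w , l) ∷ a) (e ∷ ag) t with E v w in vw | c v ≟ l
  ... | true  | yes cv≡l = pr v w (subst T (≡.sym vw) _) (≡.trans cv≡l (≡.sym e))
  ... | true  | no _     = clash-sound pr a ag t
  ... | false | _        = clash-sound pr a ag t

  all-fail : ∀ {X : Set} (f : Fin r → Maybe X) {k} ks → k ∈ ks →
             foldr (λ k rest → f k <∣> rest) nothing ks ≡ nothing → f k ≡ nothing
  all-fail f (k ∷ ks) k∈ eq with f k in fk
  all-fail f (k ∷ ks) (here refl) eq | nothing = fk
  all-fail f (k ∷ ks) (there k∈)  eq | nothing = all-fail f ks k∈ eq

  -- Follow the branch that gives each vertex `v` the colour `c v`: it never clashes and reaches the
  -- empty list of vertices, where the search succeeds.
  extend-sound : ∀ {c} → Proper E c → ∀ vs a → Agrees c a → extend vs a ≢ nothing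
  extend-sound {c} pr (v ∷ vs) a ag eq
    with clash v (c v) a in cl | all-fail (try v vs a) (allFin r) (∈-allFin (c v)) eq
  ... | true  | _   = clash-sound pr a ag (subst T (≡.sym cl) _)
  ... | false | eq′ = extend-sound pr vs ((v , c v) ∷ a) (refl ∷ ag) eq′

  extensible : List (Fin m) → Partial → Bool
  extensible vs a = is-just (extend vs a)

  -- Read contrapositively, a search that evaluates to failure rules out every proper colouring with
  -- the given start.
  extensible-complete : ∀ {c} → Proper E c → ∀ vs a → Agrees c a → T (extensible vs a)
  extensible-complete pr vs a ag with extend vs a in eq
  ... | just _  = _
  ... | nothing = extend-sound pr vs a ag eq

-- Unlisted vertices default to colour zero; every colouring read off in this way is afterwards
-- checked by `colours?`.
colourOf : {m r : ℕ} → List (Fin m × Fin (suc r)) → Fin m → Fin (suc r)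
colourOf []             v = zero
colourOf ((w , k) ∷ a) v = if isYes (v ≟ w) then k else colourOf a v

-- The two blocks

data Kind : Set where
  A B : Kind

Local : Set
Local = Fin 19

pattern source = zero
pattern sink = suc zero
pattern inner o   = suc (suc o)

-- Adjacency lists, found by computer search.  Vertices 0 and 1 are the terminals; the numbering
-- keeps the backtracking in the order 2, 3, …, 18 small.
neighbours : Kind → Vec (List ℕ) 19
neighbours A =
  (2 ∷ 9 ∷ []) ∷ (12 ∷ 15 ∷ []) ∷ (0 ∷ 3 ∷ 4 ∷ 17 ∷ []) ∷ (2 ∷ 4 ∷ 7 ∷ 18 ∷ []) ∷
  (2 ∷ 3 ∷ 5 ∷ 6 ∷ []) ∷ (4 ∷ 6 ∷ 7 ∷ 8 ∷ []) ∷ (4 ∷ 5 ∷ 8 ∷ 9 ∷ []) ∷ (3 ∷ 5 ∷ 8 ∷ 14 ∷ []) ∷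
  (5 ∷ 6 ∷ 7 ∷ 10 ∷ []) ∷ (0 ∷ 6 ∷ 10 ∷ 11 ∷ []) ∷ (8 ∷ 9 ∷ 11 ∷ 14 ∷ []) ∷
  (9 ∷ 10 ∷ 12 ∷ 13 ∷ []) ∷ (1 ∷ 11 ∷ 13 ∷ 15 ∷ []) ∷ (11 ∷ 12 ∷ 14 ∷ 16 ∷ []) ∷
  (7 ∷ 10 ∷ 13 ∷ 18 ∷ []) ∷ (1 ∷ 12 ∷ 16 ∷ 17 ∷ []) ∷ (13 ∷ 15 ∷ 17 ∷ 18 ∷ []) ∷
  (2 ∷ 15 ∷ 16 ∷ 18 ∷ []) ∷ (3 ∷ 14 ∷ 16 ∷ 17 ∷ []) ∷ []
neighbours B =
  (3 ∷ 6 ∷ []) ∷ (2 ∷ 14 ∷ []) ∷ (1 ∷ 3 ∷ 4 ∷ 15 ∷ []) ∷ (0 ∷ 2 ∷ 4 ∷ 5 ∷ []) ∷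
  (2 ∷ 3 ∷ 5 ∷ 7 ∷ []) ∷ (3 ∷ 4 ∷ 6 ∷ 8 ∷ []) ∷ (0 ∷ 5 ∷ 12 ∷ 13 ∷ []) ∷ (4 ∷ 8 ∷ 9 ∷ 10 ∷ []) ∷
  (5 ∷ 7 ∷ 9 ∷ 12 ∷ []) ∷ (7 ∷ 8 ∷ 10 ∷ 11 ∷ []) ∷ (7 ∷ 9 ∷ 11 ∷ 17 ∷ []) ∷
  (9 ∷ 10 ∷ 12 ∷ 18 ∷ []) ∷ (6 ∷ 8 ∷ 11 ∷ 13 ∷ []) ∷ (6 ∷ 12 ∷ 14 ∷ 18 ∷ []) ∷
  (1 ∷ 13 ∷ 15 ∷ 16 ∷ []) ∷ (2 ∷ 14 ∷ 16 ∷ 17 ∷ []) ∷ (14 ∷ 15 ∷ 17 ∷ 18 ∷ []) ∷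
  (10 ∷ 15 ∷ 16 ∷ 18 ∷ []) ∷ (11 ∷ 13 ∷ 16 ∷ 17 ∷ []) ∷ []

joined : Kind → Local → Local → Bool
joined κ p q = any (_≡ᵇ toℕ q) (lookup (neighbours κ) p)

joined-sym : ∀ κ p q → joined κ p q ≡ joined κ q p
joined-sym A = toWitness {a? = all? λ p → all? λ q → _ Bool.≟ _} _
joined-sym B = toWitness {a? = all? λ p → all? λ q → _ Bool.≟ _} _

joined-irrefl : ∀ κ p → joined κ p p ≡ false
joined-irrefl A = toWitness {a? = all? λ p → _ Bool.≟ _} _
joined-irrefl B = toWitness {a? = all? λ p → _ Bool.≟ _} _

without : Local → Local → (Local → Local → Bool) → Local → Local → Bool
without p q E x y =
  E x y ∧ not ((isYes (x ≟ p) ∧ isYes (y ≟ q)) ∨ (isYes (x ≟ q) ∧ isYes (y ≟ p)))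

without-intro : ∀ E p q x y → T (E x y) → ¬ (x ≡ p × y ≡ q) → ¬ (x ≡ q × y ≡ p) → T (without p q E x y)
without-intro E p q x y e n₁ n₂ with E x y | x ≟ p | y ≟ q | x ≟ q | y ≟ p
... | true | yes a | yes b | _     | _     = ⊥-elim (n₁ (a , b))
... | true | _     | _     | yes a | yes b = ⊥-elim (n₂ (a , b))
... | true | no _  | _     | no _  | _     = _
... | true | no _  | _     | yes _ | no _  = _
... | true | yes _ | no _  | no _  | _     = _
... | true | yes _ | no _  | yes _ | no _  = _

-- Colourings of a block with prescribed terminal colours

interior : List Local
interior = List.tabulate (λ i → suc (suc i))

start : ∀ {r} → Fin r → Fin r → List (Local × Fin r)
start a b = (source , a) ∷ (sink , b) ∷ []

Colours : ∀ {r} → (Local → Local → Bool) → Fin r → Fin r → (Local → Fin r) → Set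
Colours E a b c = c source ≡ a × c sink ≡ b × Proper E c

colours? : ∀ {r} E a b (c : Local → Fin r) → Dec (Colours E a b c)
colours? E a b c = (_ ≟ _) ×-dec (_ ≟ _) ×-dec
  all? λ p → all? λ q → T? _ →-dec ¬? (c p ≟ c q)

good? : ∀ {r} E a b (l : List (Local × Fin (suc r))) → Dec (Colours E a b (colourOf l))
good? E a b l = colours? E a b (colourOf l)

-- A failed search becomes the empty list, that is a constant colouring, which the later check
-- rejects as soon as `E` has an edge.
find : ∀ {r} → (Local → Local → Bool) → Fin (suc r) → Fin (suc r) → List (Local × Fin (suc r))
find E a b = fromMaybe [] (Search.extend E interior (start a b))

Colourings : ∀ {r} → (Local → Local → Bool) → Fin (suc r) → Fin (suc r) → Set
Colourings E a b = ∃ (Colours E a b)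

found : ∀ {r} E (a b : Fin (suc r)) → True (good? E a b (find E a b)) → Colourings E a b
found E a b ok = _ , toWitness ok

-- The colouring is the output of the search instead of an existential witness, which makes the
-- statement decidable.
CriticalFor : Kind → Fin 3 → Fin 3 → Set
CriticalFor κ a b = ∀ p q → T (joined κ p q) →
  Colours (without p q (joined κ)) a b (colourOf (find (without p q (joined κ)) a b))

criticalFor? : ∀ κ a b → Dec (CriticalFor κ a b)
criticalFor? κ a b = all? λ p → all? λ q → T? _ →-dec
  good? (without p q (joined κ)) a b (find (without p q (joined κ)) a b)

A-critical : ∀ p q → T (joined A p q) → Colourings {2} (without p q (joined A)) (# 0) (# 1)
A-critical p q e = _ , toWitness {a? = criticalFor? A (# 0) (# 1)} _ p q e

B-critical : ∀ p q → T (joined B p q) → Colourings {2} (without p q (joined B)) (# 0) (# 0)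
B-critical p q e = _ , toWitness {a? = criticalFor? B (# 0) (# 0)} _ p q e

A-constant₀ : Colourings {2} (joined A) (# 0) (# 0)
A-constant₀ = found _ _ _ _

A-constant₁ : Colourings {2} (joined A) (# 1) (# 1)
A-constant₁ = found _ _ _ _

-- When an edge of an A is deleted, the terminal colour changes from 0 to 1 across that A; B then
-- takes it from 1 back to 0.
B-varied : Colourings {2} (joined B) (# 1) (# 0)
B-varied = found _ _ _ _

four-colours : ∀ κ → Colourings {3} (joined κ) (# 0) (# 0)
four-colours A = found _ _ _ _
four-colours B = found _ _ _ _

-- The search is evaluated for all nine choices of terminal colours.
A-extensible : ∀ a b → T (Search.extensible (joined A) interior (start {3} a b)) → a ≡ b
A-extensible = toWitness {a? = all? λ a → all? λ b → T? (Search.extensible (joined A) interior (start a b)) →-dec (a ≟ b)} _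

B-extensible : ∀ a → ¬ T (Search.extensible (joined B) interior (start {3} a a))
B-extensible = toWitness {a? = all? λ a → ¬? (T? (Search.extensible (joined B) interior (start a a)))} _

agrees-start : ∀ {r} E (c : Local → Fin r) {a b} → c source ≡ a → c sink ≡ b → Search.Agrees E c (start a b)
agrees-start E c ea eb = ea ∷ eb ∷ []

A-forces : (c : Local → Fin 3) → Proper (joined A) c → c source ≡ c sink
A-forces c pr = A-extensible (c source) (c sink)
  (Search.extensible-complete (joined A) pr interior (start (c source) (c sink)) (agrees-start (joined A) c refl refl))

B-forces : (c : Local → Fin 3) → Proper (joined B) c → c source ≢ c sink
B-forces c pr eq = B-extensible (c source)
  (Search.extensible-complete (joined B) pr interior (start (c source) (c source)) (agrees-start (joined B) c refl (≡.sym eq)))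

-- 2-fold 6-colourings of the blocks

-- In A these are the colour classes of a 3-colouring, two colours each.
pairs : Kind → Vec (Fin 6 × Fin 6) 19
pairs A =
  (# 0 , # 1) ∷ (# 0 , # 1) ∷ (# 2 , # 3) ∷ (# 0 , # 1) ∷ (# 4 , # 5) ∷ (# 0 , # 1) ∷ (# 2 , # 3) ∷
  (# 2 , # 3) ∷ (# 4 , # 5) ∷ (# 4 , # 5) ∷ (# 0 , # 1) ∷ (# 2 , # 3) ∷ (# 4 , # 5) ∷
  (# 0 , # 1) ∷ (# 4 , # 5) ∷ (# 2 , # 3) ∷ (# 4 , # 5) ∷ (# 0 , # 1) ∷ (# 2 , # 3) ∷ []
pairs B =
  (# 0 , # 1) ∷ (# 0 , # 1) ∷ (# 2 , # 3) ∷ (# 4 , # 5) ∷ (# 0 , # 1) ∷ (# 2 , # 3) ∷ (# 4 , # 5) ∷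
  (# 2 , # 4) ∷ (# 0 , # 5) ∷ (# 1 , # 3) ∷ (# 0 , # 5) ∷ (# 2 , # 4) ∷ (# 1 , # 3) ∷
  (# 0 , # 2) ∷ (# 3 , # 4) ∷ (# 1 , # 5) ∷ (# 0 , # 2) ∷ (# 3 , # 4) ∷ (# 1 , # 5) ∷ []

fold : Kind → Local → Subset 6
fold κ p = let (a , b) = lookup (pairs κ) p in ⁅ a ⁆ ∪ ⁅ b ⁆

fold-size : ∀ κ p → ∣ fold κ p ∣ ≡ 2
fold-size A = toWitness {a? = all? λ p → _ ℕ.≟ _} _
fold-size B = toWitness {a? = all? λ p → _ ℕ.≟ _} _

fold-disjoint : ∀ κ p q → T (joined κ p q) → Empty (fold κ p ∩ fold κ q)
fold-disjoint A = toWitness {a? = all? λ p → all? λ q → T? _ →-dec ¬? (nonempty? _)} _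
fold-disjoint B = toWitness {a? = all? λ p → all? λ q → T? _ →-dec ¬? (nonempty? _)} _

∣p∪q∣≡∣p∣+∣q∣ : ∀ {m} (p q : Subset m) → Empty (p ∩ q) → ∣ p ∪ q ∣ ≡ ∣ p ∣ ℕ.+ ∣ q ∣
∣p∪q∣≡∣p∣+∣q∣ []          []          _  = refl
∣p∪q∣≡∣p∣+∣q∣ (true ∷ p)  (true ∷ q)  e = ⊥-elim (e (zero , Vec.here))
∣p∪q∣≡∣p∣+∣q∣ (true ∷ p)  (false ∷ q) e = cong suc (∣p∪q∣≡∣p∣+∣q∣ p q (drop-∷-Empty e))
∣p∪q∣≡∣p∣+∣q∣ (false ∷ p) (true ∷ q)  e =
  ≡.trans (cong suc (∣p∪q∣≡∣p∣+∣q∣ p q (drop-∷-Empty e))) (≡.sym (ℕ.+-suc _ _))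
∣p∪q∣≡∣p∣+∣q∣ (false ∷ p) (false ∷ q) e = ∣p∪q∣≡∣p∣+∣q∣ p q (drop-∷-Empty e)

-- Straight-line drawings of the blocks

-- Ordinates are given without their sign: A is drawn below the x-axis.
coordinates : Kind → Vec (ℕ × ℕ) 19
coordinates A =
  (0 , 0) ∷ (20 , 0) ∷ (7 , 9) ∷ (8 , 11) ∷ (7 , 11) ∷ (7 , 12) ∷ (6 , 13) ∷ (8 , 13) ∷ (7 , 13) ∷
  (3 , 14) ∷ (8 , 15) ∷ (10 , 20) ∷ (17 , 14) ∷ (11 , 14) ∷ (9 , 14) ∷ (15 , 9) ∷ (11 , 10) ∷
  (10 , 10) ∷ (9 , 11) ∷ []
coordinates B =
  (20 , 0) ∷ (0 , 0) ∷ (5 , 17) ∷ (15 , 17) ∷ (12 , 15) ∷ (13 , 13) ∷ (13 , 8) ∷ (11 , 12) ∷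
  (12 , 11) ∷ (11 , 11) ∷ (10 , 11) ∷ (10 , 10) ∷ (11 , 10) ∷ (11 , 8) ∷ (6 , 6) ∷ (7 , 8) ∷
  (8 , 8) ∷ (8 , 9) ∷ (9 , 9) ∷ []

abscissa ordinate : Kind → Local → ℕ
abscissa κ p = proj₁ (lookup (coordinates κ) p)
ordinate κ p = proj₂ (lookup (coordinates κ) p)

signed : Kind → ℕ → ℤ
signed A y = ℤ.- (+ y)
signed B y = + y

stretch : ℕ → ℕ → Kind → Local → ℤPoint
stretch s o κ p = + (s ℕ.* abscissa κ p ℕ.+ o) , signed κ (ordinate κ p)

place : Kind → Local → ℤPoint
place κ p = + abscissa κ p , signed κ (ordinate κ p)

Disjoint : {V : Set} → (u v x y : V) → Set
Disjoint u v x y = u ≢ x × u ≢ y × v ≢ x × v ≢ y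

disjoint-sym : ∀ {X : Set} {u v x y : X} → Disjoint u v x y → Disjoint x y u v
disjoint-sym (ux , uy , vx , vy) = ux ∘ ≡.sym , vx ∘ ≡.sym , uy ∘ ≡.sym , vy ∘ ≡.sym

-- A cell is a vertex or an edge.  Separating all pairs of disjoint cells gives the three
-- conditions of a plane drawing at once.
Cell : Kind → Local → Local → Set
Cell κ p q = p ≡ q ⊎ T (joined κ p q)

-- The normals of both segments, and the direction from one to the other for degenerate cases.
normals : (a b c d : ℤPoint) → List ℤPoint
normals (ax , ay) (bx , by) (cx , cy) (dx , dy) =
  (ay ℤ.- by , bx ℤ.- ax) ∷ (by ℤ.- ay , ax ℤ.- bx) ∷
  (cy ℤ.- dy , dx ℤ.- cx) ∷ (dy ℤ.- cy , cx ℤ.- dx) ∷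
  (cx ℤ.- ax , cy ℤ.- ay) ∷ []

separatedBy? : ∀ n a b c d → Dec (SeparatedBy n a b c d)
separatedBy? n a b c d = (_ ℤ.<? _) ×-dec (_ ℤ.<? _) ×-dec (_ ℤ.<? _) ×-dec (_ ℤ.<? _)

Separated : (a b c d : ℤPoint) → Set
Separated a b c d = ∃ λ n → SeparatedBy n a b c d

-- Only five candidate normals are tried, and pairs that are no cells are discarded before the inner
-- quantifiers, which keeps the evaluation small.
BlockPlane : Kind → Set
BlockPlane κ = ∀ p q → Cell κ p q → ∀ x y → Cell κ x y → Disjoint p q x y →
  Any (λ n → SeparatedBy n (place κ p) (place κ q) (place κ x) (place κ y))
      (normals (place κ p) (place κ q) (place κ x) (place κ y))

cell? : ∀ κ p q → Dec (Cell κ p q)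
cell? κ p q = (p ≟ q) ⊎-dec T? _

blockPlane? : ∀ κ → Dec (BlockPlane κ)
blockPlane? κ = all? λ p → all? λ q → cell? κ p q →-dec (all? λ x → all? λ y → cell? κ x y →-dec
  ((¬? (p ≟ x) ×-dec ¬? (p ≟ y) ×-dec ¬? (q ≟ x) ×-dec ¬? (q ≟ y)) →-dec any? (λ n → separatedBy? n _ _ _ _) _))

blockPlane : ∀ κ → BlockPlane κ
blockPlane A = toWitness {a? = blockPlane? A} _
blockPlane B = toWitness {a? = blockPlane? B} _

-- Multiplying the second coefficient by `s` makes the stretched value an affine function of the
-- original one, with slope `s`. Separating normals of a block thus carry over to its stretched
-- copy.
value-stretch : ∀ s o κ p α β →
  value (α , + s ℤ.* β) (stretch s o κ p) ≡ + s ℤ.* value (α , β) (place κ p) ℤ.+ α ℤ.* + o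
value-stretch s o κ p α β = ≡.trans
  (cong (λ x → α ℤ.* x ℤ.+ + s ℤ.* β ℤ.* Y)
    (≡.trans (ℤ.pos-+ (s ℕ.* X) o) (cong (ℤ._+ + o) (ℤ.pos-* s X))))
  (solve 6 (λ s o α β x y → α :* (s :* x :+ o) :+ s :* β :* y := s :* (α :* x :+ β :* y) :+ α :* o)
     refl (+ s) (+ o) α β (+ X) Y)
  where
  open ℤSolver.+-*-Solver
  X = abscissa κ p
  Y = signed κ (ordinate κ p)

stretch-< : ∀ s o κ p q n → value n (place κ p) ℤ.< value n (place κ q) →
            value (proj₁ n , + suc s ℤ.* proj₂ n) (stretch (suc s) o κ p)
            ℤ.< value (proj₁ n , + suc s ℤ.* proj₂ n) (stretch (suc s) o κ q)
stretch-< s o κ p q n@(α , β) p<q =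
  subst₂ ℤ._<_ (≡.sym (value-stretch (suc s) o κ p α β)) (≡.sym (value-stretch (suc s) o κ q α β))
    (ℤ.+-monoˡ-< (α ℤ.* + o) (ℤ.*-monoˡ-<-pos (+ suc s) p<q))

block-separated : ∀ s o κ p q x y → Cell κ p q → Cell κ x y → Disjoint p q x y →
  Separated (stretch (suc s) o κ p) (stretch (suc s) o κ q) (stretch (suc s) o κ x) (stretch (suc s) o κ y)
block-separated s o κ p q x y pq xy dis with satisfied (blockPlane κ p q pq x y xy dis)
... | n , px , py , qx , qy =
  (proj₁ n , + suc s ℤ.* proj₂ n) , stretch-< s o κ p x n px , stretch-< s o κ p y n py , stretch-< s o κ q x n qx , stretch-< s o κ q y n qy

-- Negating the normal exchanges the two sides.
separated-sym : ∀ {a b c d} → Separated a b c d → Separated c d a b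
separated-sym {a} {b} {c} {d} ((α , β) , ac , ad , bc , bd) =
  (ℤ.- α , ℤ.- β) , flip a c ac , flip b c bc , flip a d ad , flip b d bd
  where
  negated : ∀ x → value (ℤ.- α , ℤ.- β) x ≡ ℤ.- value (α , β) x
  negated (x , y) = solve 4 (λ α β x y → (:- α) :* x :+ (:- β) :* y := :- (α :* x :+ β :* y)) refl α β x y
    where open ℤSolver.+-*-Solver
  flip : ∀ x y → value (α , β) x ℤ.< value (α , β) y → value (ℤ.- α , ℤ.- β) y ℤ.< value (ℤ.- α , ℤ.- β) x
  flip x y x<y = subst₂ ℤ._<_ (≡.sym (negated y)) (≡.sym (negated x)) (ℤ.neg-mono-< x<y)

-- A point is a degenerate segment, so a vertex on an edge becomes a case of two segments that meet.
segments-meet-refl : ∀ a b c → OnSegment a b c → SegmentsMeet a b c c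
segments-meet-refl a b c@(x , y) on = c , on , 0ℚ , ℚ.≤-refl , ℚ.*≤* (ℤ.+≤+ z≤n) , stay x , stay y
  where
  open ℚSolver.+-*-Solver
  stay : ∀ x → x ≡ x ℚ.+ 0ℚ ℚ.* (x ℚ.- x)
  stay = solve 1 (λ x → x := x :+ con 0ℚ :* (x :- x)) refl

toPoint-injective : ∀ {a b} → toPoint a ≡ toPoint b → a ≡ b
toPoint-injective eq = cong₂ _,_ (fromℤ-injective (cong proj₁ eq)) (fromℤ-injective (cong proj₂ eq))

value-abscissa-< : ∀ {x x′} y y′ → x ℕ.< x′ → value (ℤ.1ℤ , ℤ.0ℤ) (+ x , y) ℤ.< value (ℤ.1ℤ , ℤ.0ℤ) (+ x′ , y′)
value-abscissa-< {x} {x′} y y′ x<x′ = subst₂ ℤ._<_ (e (+ x) y) (e (+ x′) y′) (ℤ.+<+ x<x′)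
  where
  open ℤSolver.+-*-Solver
  e : ∀ x y → x ≡ value (ℤ.1ℤ , ℤ.0ℤ) (x , y)
  e = solve 2 (λ x y → x := con ℤ.1ℤ :* x :+ con ℤ.0ℤ :* y) refl

pos-+* : ∀ a w b → + (a ℕ.+ w ℕ.* b) ≡ + a ℤ.+ + w ℤ.* + b
pos-+* a w b = ≡.trans (ℤ.pos-+ a (w ℕ.* b)) (cong (ℤ._+_ (+ a)) (ℤ.pos-* w b))

-- The first point lies below the x-axis and the second above, so after moving the negative term
-- across, the comparison is one of natural numbers.
value-rightward-< : ∀ w x x′ y y′ → x ℕ.< x′ ℕ.+ w ℕ.* (y ℕ.+ y′) →
  value (ℤ.1ℤ , + w) (+ x , ℤ.- (+ y)) ℤ.< value (ℤ.1ℤ , + w) (+ x′ , + y′)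
value-rightward-< w x x′ y y′ x< = subst₂ ℤ._<_
  (solve 3 (λ w x y → x :+ :- (w :* y) := con ℤ.1ℤ :* x :+ w :* (:- y)) refl (+ w) (+ x) (+ y))
  (≡.trans (cong (ℤ._+ c) (≡.trans (pos-+* x′ w (y ℕ.+ y′)) (cong (λ z → + x′ ℤ.+ + w ℤ.* z) (ℤ.pos-+ y y′))))
    (solve 4 (λ w x y y′ → (x :+ w :* (y :+ y′)) :+ :- (w :* y) := con ℤ.1ℤ :* x :+ w :* y′) refl (+ w) (+ x′) (+ y) (+ y′)))
  (ℤ.+-monoˡ-< c (ℤ.+<+ x<))
  where
  open ℤSolver.+-*-Solver
  c = ℤ.- (+ w ℤ.* + y)

value-leftward-< : ∀ w x x′ y y′ → x′ ℕ.< x ℕ.+ w ℕ.* (y ℕ.+ y′) →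
  value (ℤ.-1ℤ , + w) (+ x , ℤ.- (+ y)) ℤ.< value (ℤ.-1ℤ , + w) (+ x′ , + y′)
value-leftward-< w x x′ y y′ x′< = subst₂ ℤ._<_
  (solve 4 (λ w x x′ y → x′ :+ (:- x :- w :* y :- x′) := con ℤ.-1ℤ :* x :+ w :* (:- y)) refl (+ w) (+ x) (+ x′) (+ y))
  (≡.trans (cong (ℤ._+ c) (≡.trans (pos-+* x w (y ℕ.+ y′)) (cong (λ z → + x ℤ.+ + w ℤ.* z) (ℤ.pos-+ y y′))))
    (solve 5 (λ w x x′ y y′ → (x :+ w :* (y :+ y′)) :+ (:- x :- w :* y :- x′) := con ℤ.-1ℤ :* x′ :+ w :* y′)
      refl (+ w) (+ x) (+ x′) (+ y) (+ y′)))
  (ℤ.+-monoˡ-< c (ℤ.+<+ x′<))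
  where
  open ℤSolver.+-*-Solver
  c = ℤ.- (+ x) ℤ.- + w ℤ.* + y ℤ.- + x′

A-left-of-sink : ∀ p → p ≢ sink → abscissa A p ℕ.< 20
A-left-of-sink = toWitness {a? = all? λ p → ¬? (p ≟ sink) →-dec (_ ℕ.<? _)} _

A-right-of-source : ∀ p → p ≢ source → 0 ℕ.< abscissa A p
A-right-of-source = toWitness {a? = all? λ p → ¬? (p ≟ source) →-dec (_ ℕ.<? _)} _

-- After the stretch by `suc N`, these say that the inner vertices of B lie strictly above two
-- slightly tilted lines: through the left end of the ring with slope 1/`width`, and through its
-- right end with slope -1/`width`.
B-inner : ∀ o → abscissa B (inner o) ℕ.< 20 ℕ.* ordinate B (inner o) × 20 ℕ.< abscissa B (inner o) ℕ.+ 20 ℕ.* ordinate B (inner o)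
B-inner = toWitness {a? = all? λ o → (_ ℕ.<? _) ×-dec (_ ℕ.<? _)} _

-- The terminals of B are not adjacent, so no cell contains both. This decides which way the
-- separating line is tilted.
B-cell-misses-terminal : ∀ x y → Cell B x y → (x ≢ source × y ≢ source) ⊎ (x ≢ sink × y ≢ sink)
B-cell-misses-terminal = toWitness {a? = all? λ x → all? λ y → cell? B x y →-dec
  ((¬? (x ≟ source) ×-dec ¬? (y ≟ source)) ⊎-dec (¬? (x ≟ sink) ×-dec ¬? (y ≟ sink)))} _

-- The ring of blocks

-- The cyclic predecessor: the last block precedes block zero, which closes the ring.
prev : ∀ {m} → Fin (suc m) → Fin (suc m)
prev zero    = fromℕ _
prev (suc j) = inject₁ j

prev-injective : ∀ {m} {i j : Fin (suc m)} → prev i ≡ prev j → i ≡ j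
prev-injective {i = zero}  {zero}  _  = refl
prev-injective {i = zero}  {suc j} eq = ⊥-elim (fromℕ≢inject₁ eq)
prev-injective {i = suc i} {zero}  eq = ⊥-elim (fromℕ≢inject₁ (≡.sym eq))
prev-injective {i = suc i} {suc j} eq = cong suc (inject₁-injective eq)

prev-surjective : ∀ {m} (i : Fin (suc m)) → ∃ λ j → prev j ≡ i
prev-surjective i with view i
... | ‵fromℕ     = zero , refl
... | ‵inject₁ j = suc j , refl

inject₁≢suc : ∀ {m} (j : Fin m) → inject₁ j ≢ suc j
inject₁≢suc (suc j) eq = inject₁≢suc j (suc-injective eq)

-- A ring of a single block would precede itself, hence the two successors in the type.
prev-≢ : ∀ {m} (i : Fin (suc (suc m))) → prev i ≢ i
prev-≢ (suc j) = inject₁≢suc j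

-- Two duplicate-free lists with the same members are permutations of each other, so they have the
-- same length.
degree-count : (G : Graph) → ∀ v xs → Unique xs → (∀ u → u ∈ xs → Adj G v u) → (∀ u → Adj G v u → u ∈ xs) →
               degree G v ≡ length xs
degree-count G v xs unique sound complete = ↭-length (∼bag⇒↭ (unique∧set⇒bag
  (Unique.filter⁺ (T? ∘ adj G v) (Unique.allFin⁺ (n G))) unique
  (mk⇔ (λ u∈ → complete _ (proj₂ (∈-filter⁻ (T? ∘ adj G v) {xs = allFin (n G)} u∈)))
       (λ u∈ → ∈-filter⁺ (T? ∘ adj G v) (∈-allFin _) (sound _ u∈)))))

localNeighbours : Kind → Local → List Local
localNeighbours κ p = filterᵇ (joined κ p) (allFin 19)

inner-degree : ∀ κ o → length (localNeighbours κ (inner o)) ≡ 4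
inner-degree A = toWitness {a? = all? λ o → _ ℕ.≟ _} _
inner-degree B = toWitness {a? = all? λ o → _ ℕ.≟ _} _

terminal-degree : ∀ κ → length (localNeighbours κ source) ≡ 2 × length (localNeighbours κ sink) ≡ 2
terminal-degree A = refl , refl
terminal-degree B = refl , refl

module Necklace (N : ℕ) where

  Block V : Set
  Block = Fin (suc (suc N))
  V     = Block × Fin 18

  kind : Block → Kind
  kind zero    = B
  kind (suc _) = A

  -- A block owns its sink and its inner vertices; its source is the sink of the previous block.
  emb : Block → Local → V
  emb i source    = prev i , zero
  emb i (suc o) = i , o

  emb-injective : ∀ i {p q} → emb i p ≡ emb i q → p ≡ q
  emb-injective i {zero}  {zero}  _    = refl
  emb-injective i {zero}  {suc _} eq   = ⊥-elim (prev-≢ i (cong proj₁ eq))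
  emb-injective i {suc _} {zero}  eq   = ⊥-elim (prev-≢ i (cong proj₁ (≡.sym eq)))
  emb-injective i {suc _} {suc _} refl = refl

  -- A terminal is met as the sink of its own block or as the source of the next one. The third
  -- clause swaps its arguments so that symmetry holds there by definition.
  adjV : V → V → Bool
  adjV (i , zero)  (j , zero)  = false
  adjV (i , zero)  (j , suc q) =
    (isYes (i ≟ j) ∧ joined (kind j) sink (inner q)) ∨
    (isYes (i ≟ prev j) ∧ joined (kind j) source (inner q))
  adjV (i , suc p) (j , zero)  = adjV (j , zero) (i , suc p)
  adjV (i , suc p) (j , suc q) = isYes (i ≟ j) ∧ joined (kind j) (inner p) (inner q)

  adjV-sym : ∀ u v → adjV u v ≡ adjV v u
  adjV-sym (i , zero)  (j , zero)  = refl
  adjV-sym (i , zero)  (j , suc q) = refl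
  adjV-sym (i , suc p) (j , zero)  = refl
  adjV-sym (i , suc p) (j , suc q) with i ≟ j | j ≟ i
  ... | yes refl | yes _   = joined-sym (kind i) (inner p) (inner q)
  ... | no _     | no _    = refl
  ... | yes i≡j  | no j≢i  = ⊥-elim (j≢i (≡.sym i≡j))
  ... | no i≢j   | yes j≡i = ⊥-elim (i≢j (≡.sym j≡i))

  adjV-irrefl : ∀ v → adjV v v ≡ false
  adjV-irrefl (i , zero)  = refl
  adjV-irrefl (i , suc p) with i ≟ i
  ... | yes _ = joined-irrefl (kind i) (inner p)
  ... | no _  = refl

  -- Adjacency with the block that contains the edge made explicit; facts about the blocks are
  -- applied through it.
  Edge : V → V → Set
  Edge u v = ∃ λ i → ∃ λ p → ∃ λ q → u ≡ emb i p × v ≡ emb i q × T (joined (kind i) p q)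

  private
    split : ∀ {a} {P : Set a} (P? : Dec P) {b} → T (isYes P? ∧ b) → P × T b
    split (yes p) t = p , t

  Edge-sym : ∀ {u v} → Edge u v → Edge v u
  Edge-sym (i , p , q , eu , ev , t) = i , q , p , ev , eu , subst T (joined-sym (kind i) p q) t

  adj⇒edge : ∀ u v → T (adjV u v) → Edge u v
  adj⇒edge (i , zero) (j , suc q) t with Equivalence.to T-∨ t
  ... | inj₁ s with refl , e ← split (i ≟ j) s      = j , sink , inner q , refl , refl , e
  ... | inj₂ s with refl , e ← split (i ≟ prev j) s = j , source , inner q , refl , refl , e
  adj⇒edge (i , suc p) (j , zero)  t = Edge-sym (adj⇒edge (j , zero) (i , suc p) t)
  adj⇒edge (i , suc p) (j , suc q) t with refl , e ← split (i ≟ j) t =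
    j , inner p , inner q , refl , refl , e

  private
    join : ∀ {a} {P : Set a} (P? : Dec P) {b} → P → T b → T (isYes P? ∧ b)
    join (yes _) p t = t
    join (no ¬p) p t = ¬p p

  terminals-apart : ∀ κ → ¬ T (joined κ source source) × ¬ T (joined κ source sink) ×
                         ¬ T (joined κ sink source) × ¬ T (joined κ sink sink)
  terminals-apart A = (λ ()) , (λ ()) , (λ ()) , (λ ())
  terminals-apart B = (λ ()) , (λ ()) , (λ ()) , (λ ())

  edge⇒adj : ∀ i p q → T (joined (kind i) p q) → T (adjV (emb i p) (emb i q))
  edge⇒adj i source source e = proj₁ (terminals-apart (kind i)) e
  edge⇒adj i source sink e = proj₁ (proj₂ (terminals-apart (kind i))) e
  edge⇒adj i sink source e = proj₁ (proj₂ (proj₂ (terminals-apart (kind i)))) e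
  edge⇒adj i sink sink e = proj₂ (proj₂ (proj₂ (terminals-apart (kind i)))) e
  edge⇒adj i source (inner q) e = Equivalence.from T-∨ (inj₂ (join (prev i ≟ prev i) refl e))
  edge⇒adj i sink (inner q) e = Equivalence.from T-∨ (inj₁ (join (i ≟ i) refl e))
  edge⇒adj i (inner p) source e = edge⇒adj i source (inner p) (subst T (joined-sym (kind i) (inner p) zero) e)
  edge⇒adj i (inner p) sink e = edge⇒adj i sink (inner p) (subst T (joined-sym (kind i) (inner p) (# 1)) e)
  edge⇒adj i (inner p) (inner q) e = join (i ≟ i) refl e

  glue : {C : Set} → (Block → Local → C) → V → C
  glue f (i , o) = f i (suc o)

  -- The source is the only vertex of a block that another block owns, so agreement has to be asked
  -- for there alone.
  glue-emb : {C : Set} (f : Block → Local → C) → (∀ i → f i source ≡ f (prev i) sink) →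
             ∀ i p → glue f (emb i p) ≡ f i p
  glue-emb f coherent i zero    = ≡.sym (coherent i)
  glue-emb f coherent i (suc o) = refl

  G : Graph
  G = record
    { n      = suc (suc N) ℕ.* 18
    ; adj    = λ u v → adjV (remQuot 18 u) (remQuot 18 v)
    ; sym    = λ u v → adjV-sym (remQuot 18 u) (remQuot 18 v)
    ; irrefl = λ v → adjV-irrefl (remQuot 18 v)
    }

  Vertex : Set
  Vertex = Fin (suc (suc N) ℕ.* 18)

  decode : Vertex → V
  decode = remQuot 18

  encode : V → Vertex
  encode = uncurry combine

  decode-encode : ∀ v → decode (encode v) ≡ v
  decode-encode (i , o) = remQuot-combine i o

  encode-decode : ∀ u → encode (decode u) ≡ u
  encode-decode = combine-remQuot {suc (suc N)} 18

  decode-injective : ∀ {u v} → decode u ≡ decode v → u ≡ v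
  decode-injective {u} {v} eq = ≡.trans (≡.sym (encode-decode u)) (≡.trans (cong encode eq) (encode-decode v))

  encode-injective : ∀ {u v} → encode u ≡ encode v → u ≡ v
  encode-injective {u} {v} eq = ≡.trans (≡.sym (decode-encode u)) (≡.trans (cong decode eq) (decode-encode v))

  encode-adj : ∀ u v → T (adjV u v) → Adj G (encode u) (encode v)
  encode-adj u v = subst₂ (λ x y → T (adjV x y)) (≡.sym (decode-encode u)) (≡.sym (decode-encode v))

  -- Regularity

  next : Block → Block
  next i = proj₁ (prev-surjective i)

  prev-next : ∀ i → prev (next i) ≡ i
  prev-next i = proj₂ (prev-surjective i)

  next-prev : ∀ i → next (prev i) ≡ i
  next-prev i = prev-injective (prev-next (prev i))

  around : (i : Block) → Local → List V
  around i p = map (emb i) (localNeighbours (kind i) p)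

  -- A terminal has two neighbours in the block that it ends and two in the block that it begins.
  neighboursV : V → List V
  neighboursV (i , zero)  = around i sink ++ around (next i) source
  neighboursV (i , suc o) = around i (inner o)

  around-length : ∀ i p → length (around i p) ≡ length (localNeighbours (kind i) p)
  around-length i p = length-map (emb i) (localNeighbours (kind i) p)

  neighboursV-length : ∀ v → length (neighboursV v) ≡ 4
  neighboursV-length (i , zero)  = ≡.trans (length-++ (around i sink))
    (cong₂ ℕ._+_ (≡.trans (around-length i sink) (proj₂ (terminal-degree (kind i))))
                 (≡.trans (around-length (next i) source) (proj₁ (terminal-degree (kind (next i))))))
  neighboursV-length (i , suc o) = ≡.trans (around-length i (inner o)) (inner-degree (kind i) o)

  ∈-around⁻ : ∀ i p {v} → v ∈ around i p → ∃ λ q → T (joined (kind i) p q) × v ≡ emb i q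
  ∈-around⁻ i p v∈ with q , q∈ , eq ← ∈-map⁻ (emb i) v∈ = q , proj₂ (∈-filter⁻ (T? ∘ joined (kind i) p) {xs = allFin 19} q∈) , eq

  ∈-around⁺ : ∀ i p q → T (joined (kind i) p q) → emb i q ∈ around i p
  ∈-around⁺ i p q e = ∈-map⁺ (emb i) (∈-filter⁺ (T? ∘ joined (kind i) p) (∈-allFin q) e)

  around-unique : ∀ i p → Unique (around i p)
  around-unique i p = Unique.map⁺ (emb-injective i) (Unique.filter⁺ (T? ∘ joined (kind i) p) (Unique.allFin⁺ 19))

  -- Terminals are never adjacent to the source, the one vertex of block `i` with another owner.
  -- Hence the two halves of the neighbour list of a terminal are disjoint.
  around-terminal : ∀ i {v} → v ∈ around i sink ⊎ v ∈ around i source → proj₁ v ≡ i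
  around-terminal i (inj₁ v∈) with ∈-around⁻ i sink v∈
  ... | zero        , e , _    = ⊥-elim (proj₁ (proj₂ (proj₂ (terminals-apart (kind i)))) e)
  ... | suc zero    , e , refl = refl
  ... | suc (suc _) , e , refl = refl
  around-terminal i (inj₂ v∈) with ∈-around⁻ i source v∈
  ... | zero        , e , _    = ⊥-elim (proj₁ (terminals-apart (kind i)) e)
  ... | suc zero    , e , refl = refl
  ... | suc (suc _) , e , refl = refl

  next-≢ : ∀ i → i ≢ next i
  next-≢ i eq = prev-≢ i (≡.trans (cong prev eq) (prev-next i))

  neighboursV-unique : ∀ v → Unique (neighboursV v)
  neighboursV-unique (i , zero)  = Unique.++⁺ (around-unique i sink) (around-unique (next i) source)
    λ (∈ˡ , ∈ʳ) → next-≢ i (≡.trans (≡.sym (around-terminal i (inj₁ ∈ˡ))) (around-terminal (next i) (inj₂ ∈ʳ)))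
  neighboursV-unique (i , suc o) = around-unique i (inner o)

  around-sound : ∀ i p {v} → v ∈ around i p → T (adjV (emb i p) v)
  around-sound i p v∈ with q , e , refl ← ∈-around⁻ i p v∈ = edge⇒adj i p q e

  neighboursV-sound : ∀ u {v} → v ∈ neighboursV u → T (adjV u v)
  neighboursV-sound (i , zero) {v} v∈ with ∈-++⁻ (around i sink) v∈
  ... | inj₁ ∈ˡ = around-sound i sink ∈ˡ
  ... | inj₂ ∈ʳ = subst (λ j → T (adjV (j , zero) v)) (prev-next i) (around-sound (next i) source ∈ʳ)
  neighboursV-sound (i , suc o) v∈ = around-sound i (inner o) v∈

  neighboursV-complete : ∀ i p q → T (joined (kind i) p q) → emb i q ∈ neighboursV (emb i p)
  neighboursV-complete i source q e = ∈-++⁺ʳ (around (prev i) sink)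
    (subst (λ j → emb i q ∈ around j source) (≡.sym (next-prev i)) (∈-around⁺ i source q e))
  neighboursV-complete i sink q e = ∈-++⁺ˡ (∈-around⁺ i sink q e)
  neighboursV-complete i (inner o) q e = ∈-around⁺ i (inner o) q e

  regular : Regular 4 G
  regular v = ≡.trans
    (degree-count G v (map encode (neighboursV (decode v)))
      (Unique.map⁺ encode-injective (neighboursV-unique (decode v))) sound complete)
    (≡.trans (length-map encode (neighboursV (decode v))) (neighboursV-length (decode v)))
    where
    sound : ∀ u → u ∈ map encode (neighboursV (decode v)) → Adj G v u
    sound u u∈ with w , w∈ , refl ← ∈-map⁻ encode u∈ =
      subst (λ x → T (adjV (decode v) x)) (≡.sym (decode-encode w)) (neighboursV-sound (decode v) w∈)
    complete : ∀ u → Adj G v u → u ∈ map encode (neighboursV (decode v))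
    complete u a with i , p , q , eu , ev , e ← adj⇒edge (decode v) (decode u) a =
      subst (_∈ map encode (neighboursV (decode v))) (≡.trans (cong encode (≡.sym ev)) (encode-decode u))
        (∈-map⁺ encode (subst (λ x → emb i q ∈ neighboursV x) (≡.sym eu) (neighboursV-complete i p q e)))

  -- Chromatic number and edge-criticality

  assemble : ∀ {r} (F : Block → Local → Local → Bool) (τ : Block → Fin (suc r)) →
             (∀ i → Colourings (F i) (τ (prev i)) (τ i)) →
             ∃ λ (g : V → Fin (suc r)) → ∀ i p q → T (F i p q) → g (emb i p) ≢ g (emb i q)
  assemble F τ cs = glue f , proper
    where
    f : Block → Local → Fin _
    f i = proj₁ (cs i)
    coherent : ∀ i → f i source ≡ f (prev i) sink
    coherent i = ≡.trans (proj₁ (proj₂ (cs i))) (≡.sym (proj₁ (proj₂ (proj₂ (cs (prev i))))))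
    proper : ∀ i p q → T (F i p q) → glue f (emb i p) ≢ glue f (emb i q)
    proper i p q e = subst₂ _≢_ (≡.sym (glue-emb f coherent i p)) (≡.sym (glue-emb f coherent i q))
      (proj₂ (proj₂ (proj₂ (cs i))) p q e)

  four-colourable : Colourable G 4
  four-colourable with g , proper ← assemble (joined ∘ kind) (λ _ → # 0) (four-colours ∘ kind) =
    g ∘ decode , λ u v a same →
      let i , p , q , eu , ev , e = adj⇒edge (decode u) (decode v) a in
      proper i p q e (subst₂ (λ x y → g x ≡ g y) eu ev same)

  not-three-colourable : ¬ Colourable G 3
  -- The source of B is the sink of the last A. The A's carry the colour of the sink of B all the
  -- way to it, which B forbids.
  not-three-colourable (c , proper) = B-forces (c ∘ encode ∘ emb zero) (block-proper zero) (≡.sym (constant (fromℕ (suc N))))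
    where
    block-proper : ∀ i → Proper (joined (kind i)) (c ∘ encode ∘ emb i)
    block-proper i p q e = proper _ _ (encode-adj (emb i p) (emb i q) (edge⇒adj i p q e))
    constant : ∀ i → c (encode (zero , zero)) ≡ c (encode (i , zero))
    constant = <-weakInduction (λ i → c (encode (zero , zero)) ≡ c (encode (i , zero))) refl
      λ j ih → ≡.trans ih (A-forces (c ∘ encode ∘ emb (suc j)) (block-proper (suc j)))

  not-fewer-colourable : ∀ j → j ℕ.< 4 → ¬ Colourable G j
  not-fewer-colourable j (s≤s j≤3) (c , proper) = not-three-colourable
    ((λ v → inject≤ (c v) j≤3) , λ u v a same → proper u v a (inject≤-injective j≤3 j≤3 _ _ same))

  pruned : Block → Local → Local → Block → Local → Local → Bool
  pruned i p q i′ = if isYes (i′ ≟ i) then without p q (joined (kind i′)) else joined (kind i′)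

  -- If the edge lies in B, all terminals get colour 0. If it lies in an A, the terminals get colour
  -- 0 before that A and 1 after it.
  critical-colouring : ∀ i p q → T (joined (kind i) p q) →
    ∃ λ (g : V → Fin 3) → ∀ i′ p′ q′ → T (pruned i p q i′ p′ q′) → g (emb i′ p′) ≢ g (emb i′ q′)
  critical-colouring zero p q e = assemble (pruned zero p q) (λ _ → # 0) λ where
    zero    → B-critical p q e
    (suc j) → A-constant₀
  critical-colouring (suc j) p q e = assemble (pruned (suc j) p q) τ colourings
    where
    -- `τ i` is the colour of the sink of block `i`. The source of block `suc j` has index `toℕ j`,
    -- still coloured 0, and its sink is the first coloured 1.
    τ : Block → Fin 3
    τ i = if isYes (toℕ i ℕ.≤? toℕ j) then # 0 else # 1

    low : ∀ i → toℕ i ℕ.≤ toℕ j → τ i ≡ # 0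
    low i i≤j with toℕ i ℕ.≤? toℕ j
    ... | yes _  = refl
    ... | no i≰j = ⊥-elim (i≰j i≤j)

    high : ∀ i → toℕ j ℕ.< toℕ i → τ i ≡ # 1
    high i j<i with toℕ i ℕ.≤? toℕ j
    ... | yes i≤j = ⊥-elim (ℕ.<⇒≱ j<i i≤j)
    ... | no _    = refl

    with-terminals : ∀ i {E a b} → τ (prev i) ≡ a → τ i ≡ b → Colourings {2} E a b → Colourings E (τ (prev i)) (τ i)
    with-terminals i refl refl c = c

    colourings : ∀ i → Colourings (pruned (suc j) p q i) (τ (prev i)) (τ i)
    colourings zero = with-terminals zero
      (high (fromℕ (suc N)) (subst (toℕ j ℕ.<_) (≡.sym (toℕ-fromℕ (suc N))) (toℕ<n j))) refl B-varied
    colourings (suc k) with k ≟ j | ℕ.<-cmp (toℕ k) (toℕ j)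
    ... | yes refl | _ = with-terminals (suc k)
      (low (inject₁ k) (ℕ.≤-reflexive (toℕ-inject₁ k))) (high (suc k) ℕ.≤-refl) (A-critical p q e)
    ... | no _   | tri< k<j _ _ = with-terminals (suc k)
      (low (inject₁ k) (ℕ.≤-trans (ℕ.≤-reflexive (toℕ-inject₁ k)) (ℕ.<⇒≤ k<j))) (low (suc k) k<j) A-constant₀
    ... | no k≢j | tri≈ _ k≡j _ = ⊥-elim (k≢j (toℕ-injective k≡j))
    ... | no _   | tri> _ _ j<k = with-terminals (suc k)
      (high (inject₁ k) (subst (toℕ j ℕ.<_) (≡.sym (toℕ-inject₁ k)) j<k)) (high (suc k) (ℕ.<-trans j<k (ℕ.n<1+n _))) A-constant₁

  pruned-intro : ∀ i p q i′ p′ q′ → T (joined (kind i′) p′ q′) →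
    ¬ (emb i′ p′ ≡ emb i p × emb i′ q′ ≡ emb i q) → ¬ (emb i′ p′ ≡ emb i q × emb i′ q′ ≡ emb i p) →
    T (pruned i p q i′ p′ q′)
  pruned-intro i p q i′ p′ q′ e n₁ n₂ with i′ ≟ i
  ... | no _     = e
  ... | yes refl = without-intro (joined (kind i)) p q p′ q′ e
    (λ (a , b) → n₁ (cong (emb i) a , cong (emb i) b)) (λ (a , b) → n₂ (cong (emb i) a , cong (emb i) b))

  edge-critical : EdgeCritical 4 G
  edge-critical = (four-colourable , not-fewer-colourable) , deletion
    where
    deletion : ∀ u v → Adj G u v → ∃ λ j → j ℕ.< 4 × ColourableRel (DeleteEdge G u v) j
    deletion u v a
      with i , p , q , eu , ev , e ← adj⇒edge (decode u) (decode v) a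
      with g , proper ← critical-colouring i p q e = 3 , ℕ.≤-refl , g ∘ decode , proper′
      where
      proper′ : ∀ x y → DeleteEdge G u v x y → g (decode x) ≢ g (decode y)
      proper′ x y (b , n₁ , n₂) same
        with i′ , p′ , q′ , ex , ey , e′ ← adj⇒edge (decode x) (decode y) b =
        proper i′ p′ q′
          (pruned-intro i p q i′ p′ q′ e′
            (λ (a , b) → n₁ (identify ex a eu , identify ey b ev))
            (λ (a , b) → n₂ (identify ex a ev , identify ey b eu)))
          (subst₂ (λ x y → g x ≡ g y) ex ey same)
        where
        identify : ∀ {x u s t} → decode x ≡ s → s ≡ t → decode u ≡ t → x ≡ u
        identify xs st ut = decode-injective (≡.trans xs (≡.trans st (≡.sym ut)))

  -- Fractional chromatic number

  two-fold : HasBFold G 2 6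
  two-fold = f ∘ decode , (λ v → fold-size (kind (proj₁ (decode v))) (suc (proj₂ (decode v)))) , λ u v a →
      let i , p , q , eu , ev , e = adj⇒edge (decode u) (decode v) a in
      subst₂ (λ s t → Empty (s ∩ t)) (at eu) (at ev) (fold-disjoint (kind i) p q e)
    where
    f : V → Subset 6
    f = glue (fold ∘ kind)
    terminal : ∀ κ κ′ → fold κ source ≡ fold κ′ sink
    terminal A A = refl
    terminal A B = refl
    terminal B A = refl
    terminal B B = refl
    at : ∀ {u i p} → u ≡ emb i p → fold (kind i) p ≡ f u
    at {i = i} {p} refl = ≡.sym (glue-emb (fold ∘ kind) (λ i → terminal (kind i) (kind (prev i))) i p)

  -- A triangle needs three pairwise disjoint sets of `b` colours.
  triangle-bound : ∀ b m → HasBFold G b m → 3 ℕ.* b ℕ.≤ m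
  triangle-bound b m (f , size , disjoint) = begin
    3 ℕ.* b                             ≡⟨ solve 1 (λ b → con 3 :* b := (b :+ b) :+ b) refl b ⟩
    (b ℕ.+ b) ℕ.+ b                     ≡⟨ cong₂ ℕ._+_ (cong₂ ℕ._+_ (size x) (size y)) (size z) ⟨
    (∣ f x ∣ ℕ.+ ∣ f y ∣) ℕ.+ ∣ f z ∣   ≡⟨ cong (ℕ._+ ∣ f z ∣) (∣p∪q∣≡∣p∣+∣q∣ (f x) (f y) (disjoint x y (adjacent (# 2) (# 3)))) ⟨
    ∣ f x ∪ f y ∣ ℕ.+ ∣ f z ∣           ≡⟨ ∣p∪q∣≡∣p∣+∣q∣ (f x ∪ f y) (f z) xyz ⟨
    ∣ (f x ∪ f y) ∪ f z ∣               ≤⟨ ∣p∣≤n ((f x ∪ f y) ∪ f z) ⟩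
    m                                   ∎
    where
    open ℕ.≤-Reasoning
    open ℕSolver.+-*-Solver
    x y z : Vertex
    -- The vertices 2, 3 and 4 of B form a triangle.
    x = encode (emb zero (# 2))
    y = encode (emb zero (# 3))
    z = encode (emb zero (# 4))
    adjacent : ∀ p q {e : T (joined B p q)} → Adj G (encode (emb zero p)) (encode (emb zero q))
    adjacent p q {e} = encode-adj (emb zero p) (emb zero q) (edge⇒adj zero p q e)
    xyz : Empty ((f x ∪ f y) ∩ f z)
    xyz (k , k∈) with k∈xy , k∈z ← x∈p∩q⁻ (f x ∪ f y) (f z) k∈ with x∈p∪q⁻ (f x) (f y) k∈xy
    ... | inj₁ k∈x = disjoint x z (adjacent (# 2) (# 4)) (k , x∈p∩q⁺ (k∈x , k∈z))
    ... | inj₂ k∈y = disjoint y z (adjacent (# 3) (# 4)) (k , x∈p∩q⁺ (k∈y , k∈z))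

  fractional : FractionalChromaticNumber G 3
  fractional = (λ b m _ m<3b h → ℕ.<⇒≱ m<3b (triangle-bound b m h)) ,
    -- Since 6/2 = 3, the infimum is attained, and one colouring serves every ε.
    λ p q 1≤p _ → 2 , 6 , ℕ.s≤s ℕ.z≤n , two-fold , (begin-strict
      6 ℕ.* q                       <⟨ ℕ.m<m+n (6 ℕ.* q) (ℕ.≤-trans 1≤p (ℕ.m≤n*m p 2)) ⟩
      6 ℕ.* q ℕ.+ 2 ℕ.* p           ≡⟨ solve 2 (λ p q → con 6 :* q :+ con 2 :* p := (con 3 :* q :+ p) :* con 2) refl p q ⟩
      (3 ℕ.* q ℕ.+ p) ℕ.* 2         ∎)
    where
    open ℕ.≤-Reasoning
    open ℕSolver.+-*-Solver

  -- Planar drawing of the ring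

  growth offset : Block → ℕ
  growth zero    = N
  growth (suc _) = 0
  offset zero    = 0
  offset (suc j) = 20 ℕ.* toℕ j

  -- The stretch factor is `suc` of `growth`, hence positive: B is stretched by `suc N`, the number
  -- of A's, while each A is only shifted.
  position : Block → Local → ℤPoint
  position i = stretch (suc (growth i)) (offset i) (kind i)

  positionV : V → ℤPoint
  positionV = glue position

  -- B runs from right to left: its source lies at the sink of the last A, its sink at the origin,
  -- where the first A begins.
  position-coherent : ∀ i → position i source ≡ position (prev i) sink
  position-coherent zero = cong (λ x → + x , + 0) (≡.trans
    (solve 1 (λ n → (con 1 :+ n) :* con 20 :+ con 0 := con 20 :+ con 20 :* n) refl N)
    (cong (λ n → 20 ℕ.+ 20 ℕ.* n) (≡.sym (toℕ-fromℕ N))))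
    where open ℕSolver.+-*-Solver
  position-coherent (suc zero) = cong (λ x → + x , + 0) (solve 1 (λ n → con 0 := (con 1 :+ n) :* con 0 :+ con 0) refl N)
    where open ℕSolver.+-*-Solver
  position-coherent (suc (suc j)) = cong (λ x → + x , + 0) (≡.trans
    (solve 1 (λ n → con 20 :* (con 1 :+ n) := con 20 :+ con 20 :* n) refl (toℕ j))
    (cong (λ n → 20 ℕ.+ 20 ℕ.* n) (≡.sym (toℕ-inject₁ j))))
    where open ℕSolver.+-*-Solver

  positionV-emb : ∀ i p → positionV (emb i p) ≡ position i p
  positionV-emb = glue-emb position position-coherent

  -- The factor 1 is kept so that this agrees by definition with the first coordinate of
  -- `position (suc j) p`.
  A-abscissa : Fin (suc N) → Local → ℕ
  A-abscissa j p = 1 ℕ.* abscissa A p ℕ.+ 20 ℕ.* toℕ j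

  A-abscissa-upper : ∀ j p → A-abscissa j p ℕ.≤ 20 ℕ.* suc (toℕ j)
  A-abscissa-< : ∀ j p → p ≢ sink → A-abscissa j p ℕ.< 20 ℕ.* suc (toℕ j)
  A-abscissa-< j p p≢1 = begin-strict
    1 ℕ.* abscissa A p ℕ.+ 20 ℕ.* toℕ j ≡⟨ cong (ℕ._+ 20 ℕ.* toℕ j) (ℕ.*-identityˡ (abscissa A p)) ⟩
    abscissa A p ℕ.+ 20 ℕ.* toℕ j       <⟨ ℕ.+-monoˡ-< (20 ℕ.* toℕ j) (A-left-of-sink p p≢1) ⟩
    20 ℕ.+ 20 ℕ.* toℕ j                 ≡⟨ ℕ.*-suc 20 (toℕ j) ⟨
    20 ℕ.* suc (toℕ j)                  ∎
    where open ℕ.≤-Reasoning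
  A-abscissa-upper j p with p ≟ sink
  ... | yes refl = ℕ.≤-reflexive (≡.sym (ℕ.*-suc 20 (toℕ j)))
  ... | no p≢1   = ℕ.<⇒≤ (A-abscissa-< j p p≢1)

  A-abscissa-> : ∀ j p → p ≢ source → 20 ℕ.* toℕ j ℕ.< A-abscissa j p
  A-abscissa-> j p p≢0 = ℕ.m<n+m (20 ℕ.* toℕ j) (subst (0 ℕ.<_) (≡.sym (ℕ.*-identityˡ (abscissa A p))) (A-right-of-source p p≢0))

  A-abscissa-lower : ∀ j p → 20 ℕ.* toℕ j ℕ.≤ A-abscissa j p
  A-abscissa-lower j p = ℕ.m≤n+m (20 ℕ.* toℕ j) (1 ℕ.* abscissa A p)

  -- Each A occupies a vertical strip of width 20 and touches its borders only at its terminals, so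
  -- two strips meet at most in a shared terminal.
  AA-ordered : ∀ i j p x → toℕ i ℕ.< toℕ j → emb (suc i) p ≢ emb (suc j) x → A-abscissa i p ℕ.< A-abscissa j x
  AA-ordered i j p x i<j u≢v with p ≟ sink | x ≟ source | ℕ.m≤n⇒m<n∨m≡n i<j
  ... | no p≢1   | _        | _          = ℕ.<-≤-trans (A-abscissa-< i p p≢1) (ℕ.≤-trans (ℕ.*-monoʳ-≤ 20 i<j) (A-abscissa-lower j x))
  ... | yes refl | no x≢0   | _          = ℕ.≤-<-trans (A-abscissa-upper i p) (ℕ.≤-<-trans (ℕ.*-monoʳ-≤ 20 i<j) (A-abscissa-> j x x≢0))
  ... | yes refl | yes refl | inj₁ 1+i<j = ℕ.≤-<-trans (A-abscissa-upper i p) (ℕ.<-≤-trans (ℕ.*-monoʳ-< 20 1+i<j) (A-abscissa-lower j x))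
  -- The sink of one A is the source of the next: both names denote the same vertex.
  ... | yes refl | yes refl | inj₂ 1+i≡j = ⊥-elim (u≢v (cong (_, zero) (toℕ-injective (≡.trans 1+i≡j (≡.sym (toℕ-inject₁ j))))))

  -- The abscissa of the right end of the ring, used also as the weight of the ordinates in the
  -- tilted normals.
  width : ℕ
  width = 20 ℕ.* suc N

  block-end : ∀ (j : Fin (suc N)) → 20 ℕ.* suc (toℕ j) ℕ.≤ width
  block-end j = ℕ.*-monoʳ-≤ 20 (toℕ<n j)

  -- The vertical direction does not separate two distinct terminals on the x-axis, so it is tilted:
  -- to one side for the cells of B that miss the source, to the other for those that miss the sink.
  AB-left : ∀ j p x → x ≢ source → emb (suc j) p ≢ emb zero x →
    value (ℤ.-1ℤ , + width) (position (suc j) p) ℤ.< value (ℤ.-1ℤ , + width) (position zero x)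
  AB-left j p source x≢0 _ = ⊥-elim (x≢0 refl)
  AB-left j p sink _ u≢v = value-leftward-< width (A-abscissa j p) (suc N ℕ.* 0 ℕ.+ 0) (ordinate A p) 0 (begin-strict
    suc N ℕ.* 0 ℕ.+ 0   ≡⟨ solve 1 (λ n → (con 1 :+ n) :* con 0 :+ con 0 := con 0) refl N ⟩
    0                   <⟨ positive j p u≢v ⟩
    A-abscissa j p      ≤⟨ ℕ.m≤m+n _ _ ⟩
    A-abscissa j p ℕ.+ width ℕ.* (ordinate A p ℕ.+ 0) ∎)
    where
    open ℕ.≤-Reasoning
    open ℕSolver.+-*-Solver
    positive : ∀ j p → emb (suc j) p ≢ (zero , zero) → 0 ℕ.< A-abscissa j p
    -- The source of the first A is the sink of B.
    positive zero    source  u≢v = ⊥-elim (u≢v refl)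
    positive (suc j) source  u≢v = s≤s z≤n
    positive j       (suc o) u≢v = ℕ.≤-<-trans z≤n (A-abscissa-> j (suc o) λ ())
  AB-left j p (inner o) _ _ = value-leftward-< width (A-abscissa j p) (suc N ℕ.* X ℕ.+ 0) (ordinate A p) Y (begin-strict
    suc N ℕ.* X ℕ.+ 0                      ≡⟨ ℕ.+-identityʳ (suc N ℕ.* X) ⟩
    suc N ℕ.* X                            <⟨ ℕ.*-monoʳ-< (suc N) (proj₁ (B-inner o)) ⟩
    suc N ℕ.* (20 ℕ.* Y)                   ≡⟨ solve 2 (λ n y → (con 1 :+ n) :* (con 20 :* y) := (con 20 :* (con 1 :+ n)) :* y) refl N Y ⟩
    width ℕ.* Y                            ≤⟨ ℕ.*-monoʳ-≤ width (ℕ.m≤n+m Y (ordinate A p)) ⟩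
    width ℕ.* (ordinate A p ℕ.+ Y)            ≤⟨ ℕ.m≤n+m _ (A-abscissa j p) ⟩
    A-abscissa j p ℕ.+ width ℕ.* (ordinate A p ℕ.+ Y) ∎)
    where
    open ℕ.≤-Reasoning
    open ℕSolver.+-*-Solver
    X = abscissa B (inner o)
    Y = ordinate B (inner o)

  AB-right : ∀ j p x → x ≢ sink → emb (suc j) p ≢ emb zero x →
    value (ℤ.1ℤ , + width) (position (suc j) p) ℤ.< value (ℤ.1ℤ , + width) (position zero x)
  AB-right j p sink x≢1 _ = ⊥-elim (x≢1 refl)
  AB-right j p source _ u≢v = value-rightward-< width (A-abscissa j p) (suc N ℕ.* 20 ℕ.+ 0) (ordinate A p) 0 (begin-strict
    A-abscissa j p        <⟨ before-end ⟩
    width                 ≡⟨ solve 1 (λ n → con 20 :* (con 1 :+ n) := (con 1 :+ n) :* con 20 :+ con 0) refl N ⟩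
    suc N ℕ.* 20 ℕ.+ 0    ≤⟨ ℕ.m≤m+n _ _ ⟩
    suc N ℕ.* 20 ℕ.+ 0 ℕ.+ width ℕ.* (ordinate A p ℕ.+ 0) ∎)
    where
    open ℕ.≤-Reasoning
    open ℕSolver.+-*-Solver
    before-end : A-abscissa j p ℕ.< width
    before-end with p ≟ sink | ℕ.m≤n⇒m<n∨m≡n (toℕ<n j)
    ... | no p≢1   | _           = ℕ.<-≤-trans (A-abscissa-< j p p≢1) (block-end j)
    ... | yes refl | inj₁ 1+j<1+N = ℕ.≤-<-trans (A-abscissa-upper j p) (ℕ.*-monoʳ-< 20 1+j<1+N)
    -- The sink of the last A is the source of B.
    ... | yes refl | inj₂ 1+j≡1+N = ⊥-elim (u≢v (cong (_, zero)
            (toℕ-injective (≡.trans 1+j≡1+N (≡.sym (toℕ-fromℕ (suc N)))))))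
  AB-right j p (inner o) _ _ = value-rightward-< width (A-abscissa j p) (suc N ℕ.* X ℕ.+ 0) (ordinate A p) Y (begin-strict
    A-abscissa j p                         ≤⟨ A-abscissa-upper j p ⟩
    20 ℕ.* suc (toℕ j)                     ≤⟨ block-end j ⟩
    20 ℕ.* suc N                           ≡⟨ ℕ.*-comm 20 (suc N) ⟩
    suc N ℕ.* 20                           <⟨ ℕ.*-monoʳ-< (suc N) (proj₂ (B-inner o)) ⟩
    suc N ℕ.* (X ℕ.+ 20 ℕ.* Y)             ≡⟨ solve 3 (λ n x y → (con 1 :+ n) :* (x :+ con 20 :* y) := ((con 1 :+ n) :* x :+ con 0) :+ (con 20 :* (con 1 :+ n)) :* y) refl N X Y ⟩
    (suc N ℕ.* X ℕ.+ 0) ℕ.+ width ℕ.* Y    ≤⟨ ℕ.+-monoʳ-≤ (suc N ℕ.* X ℕ.+ 0) (ℕ.*-monoʳ-≤ width (ℕ.m≤n+m Y (ordinate A p))) ⟩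
    (suc N ℕ.* X ℕ.+ 0) ℕ.+ width ℕ.* (ordinate A p ℕ.+ Y) ∎)
    where
    open ℕ.≤-Reasoning
    open ℕSolver.+-*-Solver
    X = abscissa B (inner o)
    Y = ordinate B (inner o)

  AA-separated : ∀ i j p q x y → toℕ i ℕ.< toℕ j →
    Disjoint (emb (suc i) p) (emb (suc i) q) (emb (suc j) x) (emb (suc j) y) →
    Separated (position (suc i) p) (position (suc i) q) (position (suc j) x) (position (suc j) y)
  AA-separated i j p q x y i<j (px , py , qx , qy) =
    (ℤ.1ℤ , ℤ.0ℤ) , below p x px , below p y py , below q x qx , below q y qy
    where
    below : ∀ p x → emb (suc i) p ≢ emb (suc j) x →
      value (ℤ.1ℤ , ℤ.0ℤ) (position (suc i) p) ℤ.< value (ℤ.1ℤ , ℤ.0ℤ) (position (suc j) x)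
    below p x u≢v = value-abscissa-< (proj₂ (position (suc i) p)) (proj₂ (position (suc j) x)) (AA-ordered i j p x i<j u≢v)

  AB-separated : ∀ j p q x y → Cell B x y →
    Disjoint (emb (suc j) p) (emb (suc j) q) (emb zero x) (emb zero y) →
    Separated (position (suc j) p) (position (suc j) q) (position zero x) (position zero y)
  AB-separated j p q x y xy (px , py , qx , qy) = [ left , right ]′ (B-cell-misses-terminal x y xy)
    where
    left : x ≢ source × y ≢ source → _
    left (x≢0 , y≢0) = (ℤ.-1ℤ , + width) ,
      AB-left j p x x≢0 px , AB-left j p y y≢0 py , AB-left j q x x≢0 qx , AB-left j q y y≢0 qy
    right : x ≢ sink × y ≢ sink → _
    right (x≢1 , y≢1) = (ℤ.1ℤ , + width) ,
      AB-right j p x x≢1 px , AB-right j p y y≢1 py , AB-right j q x x≢1 qx , AB-right j q y y≢1 qy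

  position-separated : ∀ i p q j x y → Cell (kind i) p q → Cell (kind j) x y →
    Disjoint (emb i p) (emb i q) (emb j x) (emb j y) →
    Separated (position i p) (position i q) (position j x) (position j y)
  position-separated i p q j x y pq xy dis with i ≟ j
  position-separated i p q .i x y pq xy (px , py , qx , qy) | yes refl =
    block-separated (growth i) (offset i) (kind i) p q x y pq xy
      (px ∘ cong (emb i) , py ∘ cong (emb i) , qx ∘ cong (emb i) , qy ∘ cong (emb i))
  position-separated zero p q zero x y pq xy dis | no i≢j = ⊥-elim (i≢j refl)
  position-separated zero p q (suc j) x y pq xy dis | no _ =
    separated-sym {position (suc j) x} {position (suc j) y} {position zero p} {position zero q}
      (AB-separated j x y p q pq (disjoint-sym dis))
  position-separated (suc i) p q zero x y pq xy dis | no _ = AB-separated i p q x y xy dis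
  position-separated (suc i) p q (suc j) x y pq xy dis | no i≢j with ℕ.<-cmp (toℕ i) (toℕ j)
  ... | tri< i<j _ _ = AA-separated i j p q x y i<j dis
  ... | tri≈ _ i≡j _ = ⊥-elim (i≢j (cong suc (toℕ-injective i≡j)))
  ... | tri> _ _ j<i =
    separated-sym {position (suc j) x} {position (suc j) y} {position (suc i) p} {position (suc i) q}
      (AA-separated j i x y p q j<i (disjoint-sym dis))

  CellV : V → V → Set
  CellV u v = u ≡ v ⊎ T (adjV u v)

  cell-block : ∀ u v → CellV u v → ∃ λ i → ∃ λ p → ∃ λ q → u ≡ emb i p × v ≡ emb i q × Cell (kind i) p q
  cell-block (i , o) .(i , o) (inj₁ refl) = i , suc o , suc o , refl , refl , inj₁ refl
  cell-block u v (inj₂ a) with i , p , q , eu , ev , e ← adj⇒edge u v a = i , p , q , eu , ev , inj₂ e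

  separatedV : ∀ u v x y → CellV u v → CellV x y → Disjoint u v x y →
    Separated (positionV u) (positionV v) (positionV x) (positionV y)
  separatedV u v x y uv xy dis
    with i , p , q , refl , refl , pq ← cell-block u v uv
       | j , r , s , refl , refl , rs ← cell-block x y xy =
    subst₂ (λ a b → Separated a b (positionV (emb j r)) (positionV (emb j s)))
      (≡.sym (positionV-emb i p)) (≡.sym (positionV-emb i q))
      (subst₂ (Separated (position i p) (position i q)) (≡.sym (positionV-emb j r)) (≡.sym (positionV-emb j s))
        (position-separated i p q j r s pq rs dis))

  planar : Planar G
  planar = draw , injective , avoids-vertices , avoids-edges
    where
    point : V → Point
    point = toPoint ∘ positionV
    draw : Vertex → Point
    draw = point ∘ decode
    distinct : ∀ {u v} → u ≢ v → decode u ≢ decode v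
    distinct u≢v = u≢v ∘ decode-injective
    apart : ∀ u v x y → CellV u v → CellV x y → Disjoint u v x y → ¬ SegmentsMeet (point u) (point v) (point x) (point y)
    apart u v x y uv xy dis with n , sep ← separatedV u v x y uv xy dis =
      separated⇒¬meet n {positionV u} {positionV v} {positionV x} {positionV y} sep
    injective : ∀ u v → draw u ≡ draw v → u ≡ v
    injective u v eq with u ≟ v
    ... | yes u≡v = u≡v
    -- Distinct vertices are disjoint degenerate cells, so some functional takes different values at
    -- them.
    ... | no  u≢v with n , u<v , _ ← separatedV (decode u) (decode u) (decode v) (decode v) (inj₁ refl) (inj₁ refl)
                        (distinct u≢v , distinct u≢v , distinct u≢v , distinct u≢v) =
      ⊥-elim (ℤ.<-irrefl (cong (value n) (toPoint-injective {positionV (decode u)} {positionV (decode v)} eq)) u<v)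
    avoids-vertices : ∀ u v w → Adj G u v → w ≢ u → w ≢ v → ¬ OnSegment (draw u) (draw v) (draw w)
    avoids-vertices u v w uv w≢u w≢v on =
      apart (decode u) (decode v) (decode w) (decode w) (inj₂ uv) (inj₁ refl)
        (distinct (w≢u ∘ ≡.sym) , distinct (w≢u ∘ ≡.sym) , distinct (w≢v ∘ ≡.sym) , distinct (w≢v ∘ ≡.sym))
        (segments-meet-refl (draw u) (draw v) (draw w) on)
    avoids-edges : ∀ u v x y → Adj G u v → Adj G x y → u ≢ x → u ≢ y → v ≢ x → v ≢ y →
      ¬ SegmentsMeet (draw u) (draw v) (draw x) (draw y)
    avoids-edges u v x y uv xy u≢x u≢y v≢x v≢y =
      apart (decode u) (decode v) (decode x) (decode y) (inj₂ uv) (inj₂ xy)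
        (distinct u≢x , distinct u≢y , distinct v≢x , distinct v≢y)

-- The family is infinite because the number of vertices, 18(N + 2), is unbounded.
theorem7 : (N : ℕ) → ∃ λ (G : Graph) → N ≤ n G × EdgeCritical 4 G × Regular 4 G × Planar G × FractionalChromaticNumber G 3
theorem7 N = G , large , edge-critical , regular , planar , fractional
  where
  open Necklace N
  large : N ≤ suc (suc N) ℕ.* 18
  large = ℕ.≤-trans (ℕ.m≤n+m N 2) (ℕ.m≤m*n (suc (suc N)) 18)
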